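{- For all formulas $A$ and $B$, the sequent $A \longrightarrow B$ is derivable using the rules $*L$, $*R$, $id$, and $cut$ if and only if $A \le B$ holds in the Tamari order.
   Context: Fix a set of atoms. Formulas are generated by: every atom $p$ is a formula, and if $A,B$ are formulas then $A*B$ is a (compound) formula. (Formulas are the same as fully-bracketed words, i.e. binary trees with leaves labelled by atoms.) The Tamari order $\le$ is the least reflexive and transitive relation on formulas such that $(A*B)*C \le A*(B*C)$ for all $A,B,C$ (semi-associative law), and such that $A \le A'$ implies $A*B \le A'*B$ and $B \le B'$ implies $A*B \le A*B'$ (monotonicity). A context ($\Gamma,\Delta,\Theta$) is a possibly empty finite list of formulas; comma denotes concatenation. A sequent $\Gamma \longrightarrow A$ is a pair of a context $\Gamma$ and a formula $A$. The rules of the sequent calculus are: - $*L$: from $A,B,\Delta \longrightarrow C$ infer $A*B,\Delta \longrightarrow C$ (the product must be the leftmost formula of the context); - $*R$: from $\Gamma \longrightarrow A$ and $\Delta \longrightarrow B$ infer $\Gamma,\Delta \longrightarrow A*B$; - $id$: infer $A \longrightarrow A$ (no premises); - $cut$: from $\Theta \longrightarrow A$ and $\Gamma,A,\Delta \longrightarrow B$ infer $\Gamma,\Theta,\Delta \longrightarrow B$. A sequent is derivable if it is the conclusion of a closed derivation (a finite tree of rule instances with no undischarged premises). -}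

module Defs where

open import Data.List.Base using (List; _∷_; [_]; _++_)
open import Level using (Level)

infix  7 _*_
infix  4 _≤_ _⟶_

data Formula {a : Level} (Atom : Set a) : Set a where
  atom : Atom → Formula Atom
  _*_  : Formula Atom → Formula Atom → Formula Atom

-- The Tamari order: the least relation closed under these clauses is the
-- inductively generated one.
data _≤_ {a : Level} {Atom : Set a} : Formula Atom → Formula Atom → Set a where
  ≤-refl  : ∀ {A} → A ≤ A
  ≤-trans : ∀ {A B C} → A ≤ B → B ≤ C → A ≤ C
  assoc   : ∀ {A B C} → (A * B) * C ≤ A * (B * C)
  monoˡ   : ∀ {A A′ B} → A ≤ A′ → A * B ≤ A′ * B
  monoʳ   : ∀ {A B B′} → B ≤ B′ → A * B ≤ A * B′

Context : {a : Level} → Set a → Set a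
Context Atom = List (Formula Atom)

-- Γ ⟶ A is the type of closed derivations of the sequent, so the sequent is
-- derivable when this type is inhabited.
data _⟶_ {a : Level} {Atom : Set a} : Context Atom → Formula Atom → Set a where
  *L  : ∀ {A B Δ C} → A ∷ B ∷ Δ ⟶ C → A * B ∷ Δ ⟶ C
  *R  : ∀ {Γ Δ A B} → Γ ⟶ A → Δ ⟶ B → Γ ++ Δ ⟶ A * B
  id  : ∀ {A} → [ A ] ⟶ A
  cut : ∀ {Θ A} Γ {Δ B} → Θ ⟶ A → Γ ++ [ A ] ++ Δ ⟶ B → Γ ++ Θ ++ Δ ⟶ B

{-# OPTIONS --safe #-}
module Submission where

-- Read a nonempty context A, B₁, …, Bₙ as its left-bracketed product
-- (… (A * B₁) * …) * Bₙ, the formula foldl _*_ A (B₁ , … , Bₙ).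
--
-- From derivations to the order (soundness), every derivable sequent Γ ⟶ C
-- has Γ nonempty with left-bracketed product below C.  Under this reading *L
-- changes nothing, while *R and cut rest on two facts: foldl-monoˡ
-- (the product is monotone in its first factor), and foldl-assoc (repeated
-- semi-association gives foldl _*_ (A * B) Δ ≤ A * foldl _*_ B Δ).
--
-- Conversely (completeness), each clause generating the order is derivable
-- between singleton contexts.

open import Defs
open import Level using (Level)
open import Data.Empty.Polymorphic using (⊥)
open import Data.List.Base using ([]; _∷_; [_]; _++_; foldl)
open import Data.List.Properties using (foldl-++)
open import Function.Bundles using (_⇔_; mk⇔)
open import Relation.Binary.PropositionalEquality using (_≡_; refl; sym)

private
  variable
    a : Level
    Atom : Set a
    A B C : Formula Atom
    Γ : Context Atom

≤-reflexive : A ≡ B → A ≤ B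
≤-reflexive refl = ≤-refl

foldl-monoˡ : ∀ Δ → A ≤ B → foldl _*_ A Δ ≤ foldl _*_ B Δ
foldl-monoˡ []      A≤B = A≤B
foldl-monoˡ (D ∷ Δ) A≤B = foldl-monoˡ Δ (monoˡ A≤B)

foldl-assoc : ∀ Δ → foldl _*_ (A * B) Δ ≤ A * foldl _*_ B Δ
foldl-assoc []      = ≤-refl
foldl-assoc (D ∷ Δ) = ≤-trans (foldl-monoˡ Δ assoc) (foldl-assoc Δ)

-- Validity of the sequent Γ ⟶ C in the Tamari order: the left-bracketed
-- product of Γ is below C.  The empty context has no product, so it is below
-- nothing.
_⊨_ : {Atom : Set a} → Context Atom → Formula Atom → Set a
[]      ⊨ C = ⊥
(A ∷ Γ) ⊨ C = foldl _*_ A Γ ≤ C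

-- By foldl-assoc, the product of Γ , Δ is below
-- (product of Γ) * (product of Δ).
⊨-*R : ∀ Γ Δ → Γ ⊨ A → Δ ⊨ B → (Γ ++ Δ) ⊨ (A * B)
⊨-*R (G ∷ Γ) (D ∷ Δ) Γ⊨A Δ⊨B =
  ≤-trans (≤-reflexive (foldl-++ _*_ G Γ (D ∷ Δ)))
    (≤-trans (foldl-assoc Δ)
      (≤-trans (monoˡ Γ⊨A) (monoʳ Δ⊨B)))

-- If Γ is empty, the product of Θ is the initial part of the whole product,
-- and A replaces it by monotonicity.  Otherwise the initial part is the
-- product of Γ , Θ, which foldl-assoc bounds by (product of Γ) * (product of Θ)
-- and hence by (product of Γ) * A.
⊨-cut : ∀ Γ Θ Δ → Θ ⊨ A → (Γ ++ [ A ] ++ Δ) ⊨ B → (Γ ++ Θ ++ Δ) ⊨ B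
⊨-cut []      (T ∷ Θ) Δ Θ⊨A A,Δ⊨B =
  ≤-trans (≤-reflexive (foldl-++ _*_ T Θ Δ))
    (≤-trans (foldl-monoˡ Δ Θ⊨A) A,Δ⊨B)
⊨-cut {A = A} (G ∷ Γ) Θ@(_ ∷ Θ′) Δ Θ⊨A Γ,A,Δ⊨B =
  ≤-trans (≤-reflexive (foldl-++ _*_ G Γ (Θ ++ Δ)))
    (≤-trans (≤-reflexive (foldl-++ _*_ (foldl _*_ G Γ) Θ Δ))
      (≤-trans (foldl-monoˡ Δ (≤-trans (foldl-assoc Θ′) (monoʳ Θ⊨A)))
        (≤-trans (≤-reflexive (sym (foldl-++ _*_ G Γ (A ∷ Δ))))
          Γ,A,Δ⊨B)))

soundness : Γ ⟶ C → Γ ⊨ C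
soundness (*L d)              = soundness d
soundness (*R {Γ} {Δ} d e)    = ⊨-*R Γ Δ (soundness d) (soundness e)
soundness id                  = ≤-refl
soundness (cut {Θ} Γ {Δ} d e) = ⊨-cut Γ Θ Δ (soundness d) (soundness e)

completeness : A ≤ B → [ A ] ⟶ B
completeness ≤-refl        = id
completeness (≤-trans p q) = cut [] (completeness p) (completeness q)
completeness assoc         = *L (*L (*R id (*R id id)))
completeness (monoˡ p)     = *L (*R (completeness p) id)
completeness (monoʳ p)     = *L (*R id (completeness p))

claimI1 : ∀ {a : Level} {Atom : Set a} (A B : Formula Atom) →
    ([ A ] ⟶ B) ⇔ (A ≤ B)
claimI1 A B = mk⇔ soundness completeness
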